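{- Let $H$ be an oriented graph of order $N$, and put $d=\delta^0(H)$. If $d\ge3$ and $7d\ge2N+3$, then for every ordered pair $(x,y)$ of distinct vertices of $H$ there is a directed path from $x$ to $y$ in $H$ of length $3$, $4$, or $5$.
   Context: An oriented graph is an orientation of a (finite) simple graph: no loops, and at most one arc on each unordered pair of vertices. $\delta^0(H)=\min_{v}\min\{d^+(v),d^-(v)\}$ is the minimum semidegree. Paths are directed and simple (no repeated vertices), and the length is the number of arcs. -}

module Defs where

open import Data.Fin.Base using (Fin; zero)
open import Data.Fin.Subset using (Subset; ∣_∣)
open import Data.List.Base as List using ()
open import Data.List.Extrema.Nat using (min)
open import Data.Nat.Base using (ℕ; zero; suc; _⊓_)
open import Data.Vec.Base using (Vec; tabulate; head; last)
open import Data.Vec.Relation.Unary.Linked using (Linked)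
open import Data.Vec.Relation.Unary.Unique.Propositional using (Unique)
open import Level using (0ℓ)
open import Relation.Binary.Core using (Rel)
open import Relation.Binary.Definitions using (Asymmetric; Decidable; Irreflexive)
open import Relation.Binary.PropositionalEquality.Core using (_≡_)
open import Relation.Nullary.Decidable.Core using (does)

-- The vertices of an oriented graph of order N are the elements of Fin N.
-- Arcs are decidable so that degrees are computable; classically this is no
-- restriction on a finite graph.

record OrientedGraph (N : ℕ) : Set₁ where
  infix 4 _⟶_ _⟶?_
  field
    _⟶_     : Rel (Fin N) 0ℓ
    _⟶?_    : Decidable _⟶_
    loopless : Irreflexive _≡_ _⟶_
    asym     : Asymmetric _⟶_

  N⁺ : Fin N → Subset N
  N⁺ v = tabulate (λ w → does (v ⟶? w))

  N⁻ : Fin N → Subset N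
  N⁻ v = tabulate (λ u → does (u ⟶? v))

  d⁺ : Fin N → ℕ
  d⁺ v = ∣ N⁺ v ∣

  d⁻ : Fin N → ℕ
  d⁻ v = ∣ N⁻ v ∣

-- `min` takes an initial value besides the list; using the value at vertex
-- zero (which also occurs in the list) leaves exactly the minimum over all
-- vertices.  The graph of order 0 gets the value 0 by convention.

δ⁰ : ∀ {N} → OrientedGraph N → ℕ
δ⁰ {zero}  H = 0
δ⁰ {suc n} H = min (semidegree zero) (List.tabulate semidegree)
  where
  open OrientedGraph H
  semidegree : Fin (suc n) → ℕ
  semidegree v = d⁺ v ⊓ d⁻ v

-- The length ℓ counts arcs, so there are suc ℓ vertices.

record Path {N} (H : OrientedGraph N) (x y : Fin N) (ℓ : ℕ) : Set where
  open OrientedGraph H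
  field
    vertices : Vec (Fin N) (suc ℓ)
    starts   : head vertices ≡ x
    ends     : last vertices ≡ y
    arcs     : Linked _⟶_ vertices
    simple   : Unique vertices

{-# OPTIONS --safe #-}

-- Suppose there is no such path.  Let A = N⁺(x) ∖ {y}, B = N⁻(y) ∖ {x}, Z = A ∩ B,
-- and let C, D be the remaining out-neighbours of A and in-neighbours of B.  The
-- missing paths of length 3 and 4 make (A ∪ C) ∖ Z, (B ∪ D) ∖ Z and Z disjoint, and
-- those of length 5 forbid arcs from C to D except c → e with c, e on a triangle
-- through a vertex of Z which is the only in-neighbour of c in A.  Let C° be the
-- vertices of C without such an arc, the others being special.  Arcs leaving A ∖ Z stay in
-- P = (A ∖ Z) ∪ C° and arcs leaving C° stay in P ∪ R, where R is the set of
-- remaining vertices other than y.  A set of p vertices spans at most p(p − 1)/2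
-- arcs, so pd ≤ p(p − 1)/2 + |C°||R|.  If |Z| ≤ d − 2, the same count for A ∖ Z and
-- B ∖ Z bounds |P| and |(B ∪ D) ∖ Z| from below and the three estimates contradict
-- N ≤ (7d − 3)/2.  If |Z| ≥ d − 1, some vertex of Z without special out-neighbours
-- gives |P| ≥ d − 1 and the count again suffices; if there is no such vertex, the
-- special vertices alone make A ∪ C too large.
module Submission where

open import Defs
open import Data.Bool.Base using (true; false; if_then_else_)
open import Data.Empty using (⊥; ⊥-elim)
open import Data.Fin.Base using (Fin; zero; suc)
open import Data.Fin.Properties as Fin using (_≟_; any?)
open import Data.Fin.Subset using (∣_∣)
open import Data.List.Extrema.Nat using (min≤v⁺)
import Data.List.Base as List
import Data.List.Relation.Unary.Any as Any
open import Data.List.Membership.Propositional.Properties using (∈-tabulate⁺)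
open import Data.Nat.Base using (ℕ; zero; suc; _+_; _*_; _≥_; _≤_; _<_; _⊓_; z≤n; s≤s)
open import Data.Nat.Properties hiding (_≟_)
open import Data.Nat.Tactic.RingSolver using (solve-∀)
open import Data.Product.Base using (_×_; _,_; proj₁; proj₂; ∃)
open import Data.Sum.Base as Sum using (_⊎_; inj₁; inj₂; [_,_]′)
open import Data.Vec.Base using (tabulate; []; _∷_)
open import Data.Vec.Relation.Unary.All using ([]; _∷_)
import Data.Vec.Relation.Unary.AllPairs as AllPairs
import Data.Vec.Relation.Unary.Linked as Linked
open import Function.Base using (_∘_; flip)
open import Level using (0ℓ)
open import Relation.Binary.Core using (Rel)
import Relation.Binary.Definitions as B
open import Relation.Binary.PropositionalEquality.Core
  using (_≡_; _≢_; refl; sym; trans; cong; cong₂; subst; ≢-sym)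
open import Relation.Binary.PropositionalEquality.Properties using (module ≡-Reasoning)
open import Relation.Nullary.Decidable.Core
  using (Dec; yes; no; does; _×-dec_; _⊎-dec_; ¬?; decidable-stable)
open import Relation.Nullary.Negation using (¬_; contradiction)
open import Relation.Unary using (Pred; Decidable; _⊆_; _∪_; _∩_; ∁; Empty)
open import Relation.Unary.Properties using (_∪?_; _∩?_; ∁?)
open import Algebra.Properties.Semiring.Sum +-*-semiring
  using (sum; sum-syntax; ∑-comm; ∑-distrib-+; *-distribʳ-sum; sum-cong-≗)

private
  variable
    m n : ℕ
    X Y : Set
    P Q R : Pred (Fin n) 0ℓ

-- Sizes of decidable sets as sums of indicators.

⟦_⟧ : Dec X → ℕ
⟦ x? ⟧ = if does x? then 1 else 0

⟦⟧-mono : (x? : Dec X) (y? : Dec Y) → (X → Y) → ⟦ x? ⟧ ≤ ⟦ y? ⟧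
⟦⟧-mono (no _)  _       _ = z≤n
⟦⟧-mono (yes _) (yes _) _ = ≤-refl
⟦⟧-mono (yes x) (no ¬y) f = contradiction (f x) ¬y

⟦⟧-⊎-≤ : (x? : Dec X) (y? : Dec Y) → ⟦ x? ⊎-dec y? ⟧ ≤ ⟦ x? ⟧ + ⟦ y? ⟧
⟦⟧-⊎-≤ (yes _) _ = s≤s z≤n
⟦⟧-⊎-≤ (no _)  _ = ≤-refl

⟦⟧-⊎ : (x? : Dec X) (y? : Dec Y) → ¬ (X × Y) → ⟦ x? ⊎-dec y? ⟧ ≡ ⟦ x? ⟧ + ⟦ y? ⟧
⟦⟧-⊎ (no _)  _       _ = refl
⟦⟧-⊎ (yes _) (no _)  _ = refl
⟦⟧-⊎ (yes x) (yes y) ¬xy = contradiction (x , y) ¬xy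

∑-mono : {f g : Fin n → ℕ} → (∀ i → f i ≤ g i) → sum f ≤ sum g
∑-mono {n = zero}  f≤g = z≤n
∑-mono {n = suc _} f≤g = +-mono-≤ (f≤g zero) (∑-mono (f≤g ∘ suc))

♯ : Decidable P → ℕ
♯ {n} P? = ∑[ i < n ] ⟦ P? i ⟧

♯-mono : (P? : Decidable P) (Q? : Decidable Q) → P ⊆ Q → ♯ P? ≤ ♯ Q?
♯-mono P? Q? P⊆Q = ∑-mono λ i → ⟦⟧-mono (P? i) (Q? i) P⊆Q

♯-∪ : (P? : Decidable P) (Q? : Decidable Q) → Empty (P ∩ Q) →
      ♯ (P? ∪? Q?) ≡ ♯ P? + ♯ Q?
♯-∪ {n} P? Q? P∩Q=∅ =
  trans (sum-cong-≗ λ i → ⟦⟧-⊎ (P? i) (Q? i) (P∩Q=∅ i)) (∑-distrib-+ {n} _ _)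

♯-cover : (P? : Decidable P) (Q? : Decidable Q) (R? : Decidable R) →
          P ⊆ Q ∪ R → ♯ P? ≤ ♯ Q? + ♯ R?
♯-cover {n} P? Q? R? P⊆Q∪R = ≤-trans
  (∑-mono λ i → ≤-trans (⟦⟧-mono (P? i) (Q? i ⊎-dec R? i) P⊆Q∪R) (⟦⟧-⊎-≤ (Q? i) (R? i)))
  (≤-reflexive (∑-distrib-+ {n} _ _))

♯-pack : (P? : Decidable P) (Q? : Decidable Q) (R? : Decidable R) →
         Empty (P ∩ Q) → P ⊆ R → Q ⊆ R → ♯ P? + ♯ Q? ≤ ♯ R?
♯-pack P? Q? R? P∩Q=∅ P⊆R Q⊆R = ≤-trans
  (≤-reflexive (sym (♯-∪ P? Q? P∩Q=∅)))
  (♯-mono (P? ∪? Q?) R? [ P⊆R , Q⊆R ]′)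

♯-∁ : {P : Pred (Fin n) 0ℓ} (P? : Decidable P) → ♯ P? + ♯ (∁? P?) ≡ n
♯-∁ {n = zero}  P? = refl
♯-∁ {n = suc n} P? with P? zero
... | yes _ = cong suc (♯-∁ (P? ∘ suc))
... | no  _ = trans (+-suc _ _) (cong suc (♯-∁ (P? ∘ suc)))

⟦⟧≤♯ : (x? : Dec X) (P? : Decidable P) → (X → ∃ P) → ⟦ x? ⟧ ≤ ♯ P?
⟦⟧≤♯ (no _)  P? f = z≤n
⟦⟧≤♯ (yes x) P? f with f x
... | i , Pi = go i P? Pi
  where
  go : {P : Pred (Fin n) 0ℓ} (i : Fin n) (P? : Decidable P) → P i → 1 ≤ ♯ P?
  go zero    P? Pi = ≤-trans (⟦⟧-mono (yes Pi) (P? zero) (λ z → z)) (m≤m+n _ _)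
  go (suc i) P? Pi = ≤-trans (go i (P? ∘ suc) Pi) (m≤n+m _ _)

♯-empty : {P : Pred (Fin n) 0ℓ} (P? : Decidable P) → Empty P → ♯ P? ≡ 0
♯-empty {n = zero}  P? e = refl
♯-empty {n = suc _} P? e with P? zero
... | yes p = contradiction p (e zero)
... | no  _ = ♯-empty (P? ∘ suc) (e ∘ suc)

-- Dual to `⟦⟧≤♯`: in a double count, that lemma bounds a row from below by an indicator and this
-- one bounds a column from above.
♯≤⟦⟧ : {P : Pred (Fin n) 0ℓ} (P? : Decidable P) (x? : Dec X) → (∀ {i} → P i → X) →
       (∀ {i j} → P i → P j → i ≡ j) → ♯ P? ≤ ⟦ x? ⟧
♯≤⟦⟧ {n = zero}  P? x? f u = z≤n
♯≤⟦⟧ {n = suc _} P? x? f u with P? zero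
... | no  _ = ♯≤⟦⟧ (P? ∘ suc) x? f λ p q → Fin.suc-injective (u p q)
... | yes p = begin
  1 + ♯ (P? ∘ suc) ≡⟨ cong suc (♯-empty (P? ∘ suc) λ i q → Fin.0≢1+n (u p q)) ⟩
  1                ≤⟨ ⟦⟧-mono (yes (f p)) x? (λ z → z) ⟩
  ⟦ x? ⟧           ∎
  where open ≤-Reasoning

♯-singleton : (y : Fin n) → ♯ (_≟ y) ≡ 1
♯-singleton y = ≤-antisym
  (♯≤⟦⟧ (_≟ y) (yes y) (λ _ → y) λ { refl refl → refl })
  (⟦⟧≤♯ (yes y) (_≟ y) λ _ → y , refl)

-- Pays one unit for a single exceptional vertex. This is how a degree bound passes to sets such as
-- `A` and `B`, which leave out `y` or `x`.
♯-except : (y : Fin n) (P? : Decidable P) (R? : Decidable R) →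
           (∀ {v} → P v → v ≢ y → R v) → ♯ P? ≤ 1 + ♯ R?
♯-except {P = P} {R = R} y P? R? f = ≤-trans
  (♯-cover P? (_≟ y) R? split) (+-monoˡ-≤ (♯ R?) (≤-reflexive (♯-singleton y)))
  where
  split : P ⊆ (_≡ y) ∪ R
  split {v} Pv with v ≟ y
  ... | yes v≡y = inj₁ v≡y
  ... | no  v≢y = inj₂ (f Pv v≢y)

♯-inhabited : (P? : Decidable P) → 0 < ♯ P? → ∃ P
♯-inhabited P? 0<♯ with any? P?
... | yes e = e
... | no ¬e = contradiction (sym (♯-empty P? λ i p → ¬e (i , p))) (<⇒≢ 0<♯)

♯-const× : (x? : Dec X) (Q? : Decidable Q) → ♯ (λ j → x? ×-dec Q? j) ≡ ⟦ x? ⟧ * ♯ Q?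
♯-const× (yes x) Q? = sym (*-identityˡ _)
♯-const× (no ¬x) Q? = ♯-empty (λ j → no ¬x ×-dec Q? j) λ _ → ¬x ∘ proj₁

-- Double counting the pairs (i , j) with P i, Q j and E i j.
♯-injection : {E : Fin m → Fin n → Set} (E? : B.Decidable E)
              {P : Pred (Fin m) 0ℓ} (P? : Decidable P) (Q? : Decidable Q) →
              (∀ {i} → P i → ∃ λ j → Q j × E i j) →
              (∀ {i i′ j} → P i → P i′ → Q j → E i j → E i′ j → i ≡ i′) →
              ♯ P? ≤ ♯ Q?
♯-injection {m} {n} E? P? Q? image inj = begin
  ♯ P?
    ≤⟨ ∑-mono (λ i → ⟦⟧≤♯ (P? i) (T? i) λ p → let j , q , e = image p in j , p , q , e) ⟩
  ∑[ i < m ] ♯ (T? i)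
    ≡⟨ ∑-comm (λ i j → ⟦ T? i j ⟧) ⟩
  ∑[ j < n ] ♯ (flip T? j)
    ≤⟨ ∑-mono (λ j → ♯≤⟦⟧ (flip T? j) (Q? j) (proj₁ ∘ proj₂)
         λ (p , q , e) (p′ , _ , e′) → inj p p′ q e e′) ⟩
  ♯ Q? ∎
  where
  open ≤-Reasoning
  T? : ∀ i j → Dec _
  T? i j = P? i ×-dec Q? j ×-dec E? i j

-- Counting the arcs of an asymmetric relation.

module _ {E : Rel (Fin n) 0ℓ} (E? : B.Decidable E) (E-asym : B.Asymmetric E) where

  -- By asymmetry, the arcs inside `P`, their reversals and the diagonal are disjoint subsets of P ×
  -- P.
  inner-arcs : (P? : Decidable P) →
    2 * (∑[ u < n ] ♯ (λ v → P? u ×-dec P? v ×-dec E? u v)) + ♯ P? ≤ ♯ P? * ♯ P?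
  inner-arcs {P = P} P? = begin
    2 * T + ♯ P?
      ≡⟨ cong (λ t → T + t + ♯ P?) (+-identityʳ T) ⟩
    T + T + ♯ P?
      ≤⟨ +-mono-≤ (+-monoʳ-≤ T T≤T′) (∑-mono λ u →
           ⟦⟧≤♯ (P? u) (D? u) λ p → u , p , refl) ⟩
    T + ∑[ u < n ] ♯ (λ v → F′? u v) + ∑[ u < n ] ♯ (D? u)
      ≡⟨ trans (cong (_+ ∑[ u < n ] ♯ (D? u)) (sym (∑-distrib-+ {n} _ _))) (sym (∑-distrib-+ {n} _ _)) ⟩
    ∑[ u < n ] (♯ (F? u) + ♯ (F′? u) + ♯ (D? u))
      ≤⟨ ∑-mono (λ u → three u) ⟩
    ∑[ u < n ] ♯ (λ v → P? u ×-dec P? v)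
      ≡⟨ sum-cong-≗ (λ u → ♯-const× (P? u) P?) ⟩
    ∑[ u < n ] (⟦ P? u ⟧ * ♯ P?)
      ≡⟨ sym (*-distribʳ-sum {n} (♯ P?) _) ⟩
    ♯ P? * ♯ P? ∎
    where
    open ≤-Reasoning
    F? : ∀ u v → Dec (P u × P v × E u v)
    F? u v = P? u ×-dec P? v ×-dec E? u v
    F′? : ∀ u v → Dec (P u × P v × E v u)
    F′? u v = P? u ×-dec P? v ×-dec E? v u
    D? : ∀ u v → Dec (P u × u ≡ v)
    D? u v = P? u ×-dec (u ≟ v)
    T = ∑[ u < n ] ♯ (F? u)
    T≤T′ : T ≤ ∑[ u < n ] ♯ (λ v → F′? u v)
    T≤T′ = ≤-trans (≤-reflexive (∑-comm (λ u v → ⟦ F? u v ⟧)))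
      (∑-mono λ v → ♯-mono (λ u → F? u v) (F′? v) λ (p , q , e) → q , p , e)
    three : ∀ u → ♯ (F? u) + ♯ (F′? u) + ♯ (D? u) ≤ ♯ (λ v → P? u ×-dec P? v)
    three u = ≤-trans
      (+-monoˡ-≤ (♯ (D? u)) (≤-reflexive (sym (♯-∪ (F? u) (F′? u)
        λ { v ((_ , _ , e) , (_ , _ , e′)) → E-asym e e′ }))))
      (♯-pack (F? u ∪? F′? u) (D? u) (λ v → P? u ×-dec P? v)
        (λ { v (inj₁ (_ , _ , e) , _ , refl) → E-asym e e
           ; v (inj₂ (_ , _ , e) , _ , refl) → E-asym e e })
        (λ { (inj₁ (p , q , _)) → p , q ; (inj₂ (p , q , _)) → p , q })
        (λ { (p , refl) → p , p }))

  -- At least |P|d arcs start in `P`. Each of them either ends in `P`, where `inner-arcs` applies,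
  -- or is one of the |K||R| pairs in K × R. Reversing `E` turns this into a bound for in-degrees.
  outdegree-bound : {K : Pred (Fin n) 0ℓ} (d : ℕ) (P? : Decidable P) (K? : Decidable K) (R? : Decidable R) →
    (∀ u → d ≤ ♯ (E? u)) →
    (∀ {u v} → P u → E u v → P v ⊎ (K u × R v)) →
    2 * (♯ P? * d) + ♯ P? ≤ ♯ P? * ♯ P? + 2 * (♯ K? * ♯ R?)
  outdegree-bound {P = P} d P? K? R? d≤ out = begin
    2 * (♯ P? * d) + ♯ P?
      ≤⟨ +-monoˡ-≤ (♯ P?) (*-monoʳ-≤ 2 all-arcs) ⟩
    2 * (T + ♯ K? * ♯ R?) + ♯ P?
      ≡⟨ rearrange T (♯ K? * ♯ R?) (♯ P?) ⟩
    2 * T + ♯ P? + 2 * (♯ K? * ♯ R?)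
      ≤⟨ +-monoˡ-≤ _ (inner-arcs P?) ⟩
    ♯ P? * ♯ P? + 2 * (♯ K? * ♯ R?) ∎
    where
    open ≤-Reasoning
    rearrange : ∀ t s p → 2 * (t + s) + p ≡ 2 * t + p + 2 * s
    rearrange = solve-∀
    T = ∑[ u < n ] ♯ (λ v → P? u ×-dec P? v ×-dec E? u v)
    all-arcs : ♯ P? * d ≤ T + ♯ K? * ♯ R?
    all-arcs = begin
      ♯ P? * d
        ≡⟨ *-distribʳ-sum {n} d _ ⟩
      ∑[ u < n ] (⟦ P? u ⟧ * d)
        ≤⟨ ∑-mono (λ u → *-monoʳ-≤ ⟦ P? u ⟧ (d≤ u)) ⟩
      ∑[ u < n ] (⟦ P? u ⟧ * ♯ (E? u))
        ≡⟨ sum-cong-≗ (λ u → sym (♯-const× (P? u) (E? u))) ⟩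
      ∑[ u < n ] ♯ (λ v → P? u ×-dec E? u v)
        ≤⟨ ∑-mono (λ u → ♯-cover (λ v → P? u ×-dec E? u v)
             (λ v → P? u ×-dec P? v ×-dec E? u v) (λ v → K? u ×-dec R? v)
             λ (p , e) → [ (λ q → inj₁ (p , q , e)) , inj₂ ]′ (out p e)) ⟩
      ∑[ u < n ] (♯ (λ v → P? u ×-dec P? v ×-dec E? u v) + ♯ (λ v → K? u ×-dec R? v))
        ≡⟨ ∑-distrib-+ {n} _ _ ⟩
      T + ∑[ u < n ] ♯ (λ v → K? u ×-dec R? v)
        ≡⟨ cong (T +_) (trans (sum-cong-≗ λ u → ♯-const× (K? u) R?) (sym (*-distribʳ-sum {n} (♯ R?) _))) ⟩
      T + ♯ K? * ♯ R? ∎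

-- Arithmetic contradicting 2N + 3 ≤ 7d.

absurd-≤ : ∀ {l r} e → l ≤ r → l ≡ suc (r + e) → ⊥
absurd-≤ {l} {r} e l≤r l≡ = m+n≮m r e (subst (_≤ r) l≡ l≤r)

2mn≤m²+n² : ∀ m n → 2 * (m * n) ≤ m * m + n * n
2mn≤m²+n² m n = [ below m n , (λ n≤m → begin
  2 * (m * n)   ≡⟨ cong (2 *_) (*-comm m n) ⟩
  2 * (n * m)   ≤⟨ below n m n≤m ⟩
  n * n + m * m ≡⟨ +-comm (n * n) (m * m) ⟩
  m * m + n * n ∎) ]′ (≤-total m n)
  where
  open ≤-Reasoning
  square : ∀ m t → m * m + (m + t) * (m + t) ≡ 2 * (m * (m + t)) + t * t
  square = solve-∀
  below : ∀ m n → m ≤ n → 2 * (m * n) ≤ m * m + n * n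
  below m n m≤n with m≤n⇒∃[o]m+o≡n m≤n
  ... | t , refl = ≤-trans (m≤m+n _ (t * t)) (≤-reflexive (sym (square m t)))

cancel-size : ∀ {a d k} → 1 ≤ a → 2 * (a * d) + a ≤ a * a + 2 * (a * k) → 2 * d + 1 ≤ a + 2 * k
cancel-size {suc a} {d} {k} _ h = *-cancelˡ-≤ (suc a) (begin
  suc a * (2 * d + 1)               ≡⟨ l (suc a) d ⟩
  2 * (suc a * d) + suc a           ≤⟨ h ⟩
  suc a * suc a + 2 * (suc a * k)   ≡⟨ r (suc a) k ⟩
  suc a * (suc a + 2 * k)           ∎)
  where
  open ≤-Reasoning
  l : ∀ a d → a * (2 * d + 1) ≡ 2 * (a * d) + a
  l = solve-∀
  r : ∀ a k → a * a + 2 * (a * k) ≡ a * (a + 2 * k)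
  r = solve-∀

-- With d = 2 + z + w and 2p = 2z + 3w + 6 + U, the difference of the two sides of
-- the arc count is at least (w − U)² plus positive terms.
quadratic-gap : ∀ {p k r} z w U →
  2 * (p * (2 + z + w)) + p ≤ p * p + 2 * (k * r) →
  2 * z + 3 * w + 6 + U ≡ 2 * p →
  2 * k ≤ 2 * z + w + 4 + U →
  U + 2 * r + 3 ≤ z + w → ⊥
quadratic-gap {p} {k} {r} z w U arcs hU hk hr =
  absurd-≤ (16 * w + 24 * z + 2 * (z * w) + 47 + 12 * U + 2 * (z * U))
    (+-mono-≤ (subst Bound (sym hU) bound) (2mn≤m²+n² w U)) (gap z w U)
  where
  open ≤-Reasoning
  κ = 2 * z + w + 4 + U
  Bound : ℕ → Set
  Bound q = q * (4 * (z + w) + 10) + 2 * (κ * (U + 3)) ≤ q * q + 2 * (κ * (z + w))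
  gap : ∀ z w U → let q = 2 * z + 3 * w + 6 + U; κ = 2 * z + w + 4 + U in
    q * (4 * (z + w) + 10) + 2 * (κ * (U + 3)) + 2 * (w * U) ≡
    suc (q * q + 2 * (κ * (z + w)) + (w * w + U * U)
      + (16 * w + 24 * z + 2 * (z * w) + 47 + 12 * U + 2 * (z * U)))
  gap = solve-∀
  e₁ : ∀ p z w → 2 * p * (4 * (z + w) + 10) ≡ 4 * (2 * (p * (2 + z + w)) + p)
  e₁ = solve-∀
  e₂ : ∀ p k r → 4 * (p * p + 2 * (k * r)) ≡ 2 * p * (2 * p) + 2 * (2 * k * (2 * r))
  e₂ = solve-∀
  e₃ : ∀ q κ r U → q + 2 * (κ * (2 * r)) + 2 * (κ * (U + 3)) ≡ q + 2 * (κ * (U + 2 * r + 3))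
  e₃ = solve-∀
  bound : Bound (2 * p)
  bound = begin
    2 * p * (4 * (z + w) + 10) + 2 * (κ * (U + 3))
      ≡⟨ cong (_+ 2 * (κ * (U + 3))) (e₁ p z w) ⟩
    4 * (2 * (p * (2 + z + w)) + p) + 2 * (κ * (U + 3))
      ≤⟨ +-monoˡ-≤ _ (*-monoʳ-≤ 4 arcs) ⟩
    4 * (p * p + 2 * (k * r)) + 2 * (κ * (U + 3))
      ≡⟨ cong (_+ 2 * (κ * (U + 3))) (e₂ p k r) ⟩
    2 * p * (2 * p) + 2 * (2 * k * (2 * r)) + 2 * (κ * (U + 3))
      ≤⟨ +-monoˡ-≤ _ (+-monoʳ-≤ (2 * p * (2 * p)) (*-monoʳ-≤ 2 (*-monoˡ-≤ (2 * r) hk))) ⟩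
    2 * p * (2 * p) + 2 * (κ * (2 * r)) + 2 * (κ * (U + 3))
      ≡⟨ e₃ (2 * p * (2 * p)) κ r U ⟩
    2 * p * (2 * p) + 2 * (κ * (U + 2 * r + 3))
      ≤⟨ +-monoʳ-≤ (2 * p * (2 * p)) (*-monoʳ-≤ 2 (*-monoʳ-≤ κ hr)) ⟩
    2 * p * (2 * p) + 2 * (κ * (z + w)) ∎

module _ (z w : ℕ) {a k : ℕ} (d≤1+a+z : 2 + z + w ≤ 1 + (a + z)) where

  w<a : suc w ≤ a
  w<a = +-cancelʳ-≤ (1 + z) _ _
    (≤-trans (≤-reflexive (l w z)) (≤-trans d≤1+a+z (≤-reflexive (r a z))))
    where
    l : ∀ w z → suc w + (1 + z) ≡ 2 + z + w
    l = solve-∀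
    r : ∀ a z → 1 + (a + z) ≡ a + (1 + z)
    r = solve-∀

  -- Adds `w<a` to the arc count divided by `a`. Here `w` stands for d - 2 - |Z|. It is applied to
  -- `A′` with `C°` and, in the reversed graph, to `B′` with `D`.
  half-size : 2 * (a * (2 + z + w)) + a ≤ a * a + 2 * (a * k) →
              2 * z + 3 * w + 6 ≤ 2 * (a + k)
  half-size arcs = begin
    2 * z + 3 * w + 6                ≡⟨ l z w ⟩
    2 * (2 + z + w) + 1 + suc w      ≤⟨ +-mono-≤ (cancel-size (≤-trans (s≤s z≤n) w<a) arcs) w<a ⟩
    a + 2 * k + a                    ≡⟨ r a k ⟩
    2 * (a + k)                      ∎
    where
    open ≤-Reasoning
    l : ∀ z w → 2 * z + 3 * w + 6 ≡ 2 * (2 + z + w) + 1 + suc w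
    l = solve-∀
    r : ∀ a k → a + 2 * k + a ≡ 2 * (a + k)
    r = solve-∀

small-intersection : ∀ {d a b k l z r N} →
  2 + z ≤ d → d ≤ 1 + (a + z) → d ≤ 1 + (b + z) →
  2 * ((a + k) * d) + (a + k) ≤ (a + k) * (a + k) + 2 * (k * r) →
  2 * (a * d) + a ≤ a * a + 2 * (a * k) →
  2 * (b * d) + b ≤ b * b + 2 * (b * l) →
  (a + k) + (b + l) + z + 1 + r ≡ N → 2 * N + 3 ≤ 7 * d → ⊥
small-intersection {a = a} {b} {k} {l} {z} {r} 2+z≤d d≤a d≤b arcs arcsᵃ arcsᵇ refl 2N+3≤7d
  with m≤n⇒∃[o]m+o≡n 2+z≤d
... | w , refl with m≤n⇒∃[o]m+o≡n (half-size z w d≤a arcsᵃ)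
-- `U` is the excess of 2p = 2(a + k) over the bound in `half-size`.
... | U , hU = quadratic-gap {a + k} {k} {r} z w U arcs hU
  -- As a ≥ w + 1, the value of 2p limits 2k.
  (+-cancelˡ-≤ (2 * suc w) _ _ (begin
    2 * suc w + 2 * k                   ≤⟨ +-monoˡ-≤ (2 * k) (*-monoʳ-≤ 2 (w<a z w {k = k} d≤a)) ⟩
    2 * a + 2 * k                       ≡⟨ sym (*-distribˡ-+ 2 a k) ⟩
    2 * (a + k)                         ≡⟨ sym hU ⟩
    2 * z + 3 * w + 6 + U               ≡⟨ e₁ z w U ⟩
    2 * suc w + (2 * z + w + 4 + U)     ∎))
  -- The limit on `r` comes from `N`: 2p is known exactly, and `half-size` bounds 2(b + l) from
  -- below.
  (+-cancelʳ-≤ (6 * z + 6 * w + 14) _ _ (begin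
    U + 2 * r + 3 + (6 * z + 6 * w + 14)
      ≡⟨ e₂ z w U r ⟩
    (2 * z + 3 * w + 6 + U) + (2 * z + 3 * w + 6) + (2 * z + 2 * r + 5)
      ≤⟨ +-monoˡ-≤ (2 * z + 2 * r + 5) (+-mono-≤ (≤-reflexive hU) (half-size z w d≤b arcsᵇ)) ⟩
    2 * (a + k) + 2 * (b + l) + (2 * z + 2 * r + 5)
      ≡⟨ e₃ (a + k) (b + l) z r ⟩
    2 * (a + k + (b + l) + z + 1 + r) + 3
      ≤⟨ 2N+3≤7d ⟩
    7 * (2 + z + w)
      ≡⟨ e₄ z w ⟩
    z + w + (6 * z + 6 * w + 14) ∎))
  where
  open ≤-Reasoning
  e₁ : ∀ z w U → 2 * z + 3 * w + 6 + U ≡ 2 * suc w + (2 * z + w + 4 + U)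
  e₁ = solve-∀
  e₂ : ∀ z w U r → U + 2 * r + 3 + (6 * z + 6 * w + 14) ≡
       (2 * z + 3 * w + 6 + U) + (2 * z + 3 * w + 6) + (2 * z + 2 * r + 5)
  e₂ = solve-∀
  e₃ : ∀ p q z r → 2 * p + 2 * q + (2 * z + 2 * r + 5) ≡ 2 * (p + q + z + 1 + r) + 3
  e₃ = solve-∀
  e₄ : ∀ z w → 7 * (2 + z + w) ≡ z + w + (6 * z + 6 * w + 14)
  e₄ = solve-∀

-- Replacing `k` by `p` allows division of the arc count by `p`, which leaves 2d + 1 ≤ p + 2r. Added
-- to the size bounds, those for `z` and `q` doubled, this misses consistency by exactly one.
large-intersection : ∀ {d p q k z r N} →
  2 ≤ d → d ≤ 1 + z → d ≤ 1 + p → d ≤ 1 + q → k ≤ p →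
  2 * (p * d) + p ≤ p * p + 2 * (k * r) →
  p + q + z + 1 + r ≡ N → 2 * N + 3 ≤ 7 * d → ⊥
large-intersection {d} {p} {q} {k} {z} {r} 2≤d d≤1+z d≤1+p d≤1+q k≤p arcs refl 2N+3≤7d =
  absurd-≤ 0
    (+-mono-≤ (+-mono-≤ (+-mono-≤ 2N+3≤7d (*-monoʳ-≤ 2 d≤1+z)) (+-mono-≤ d≤1+p (*-monoʳ-≤ 2 d≤1+q)))
      (cancel-size (+-cancelˡ-≤ 1 _ _ (≤-trans 2≤d d≤1+p))
        (≤-trans arcs (+-monoʳ-≤ (p * p) (*-monoʳ-≤ 2 (*-monoˡ-≤ r k≤p))))))
    (e d p q z r)
  where
  e : ∀ d p q z r →
    2 * (p + q + z + 1 + r) + 3 + 2 * d + (d + 2 * d) + (2 * d + 1) ≡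
    suc (7 * d + 2 * (1 + z) + (1 + p + 2 * (1 + q)) + (p + 2 * r) + 0)
  e = solve-∀

-- The size bounds give N ≥ 4d - 2, and then 2N + 3 ≤ 7d would force d ≤ 1.
huge-neighbourhoods : ∀ {d p q z N} →
  3 ≤ d → d ≤ 1 + z → d + z ≤ 2 + p → d ≤ q →
  p + q + z + 2 ≤ N → 2 * N + 3 ≤ 7 * d → ⊥
huge-neighbourhoods {d} {p} {q} {z} {N} 3≤d d≤1+z d+z≤2+p d≤q N≥ 2N+3≤7d =
  absurd-≤ 1
    (+-mono-≤ (+-mono-≤ (+-mono-≤ (*-monoʳ-≤ 2 N≥) 2N+3≤7d) (+-mono-≤ (*-monoʳ-≤ 4 d≤1+z) (*-monoʳ-≤ 2 d+z≤2+p)))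
      (+-mono-≤ (*-monoʳ-≤ 2 d≤q) 3≤d))
    (e d p q z N)
  where
  e : ∀ d p q z N →
    2 * (p + q + z + 2) + (2 * N + 3) + (4 * d + 2 * (d + z)) + (2 * d + 3) ≡
    suc (2 * N + 7 * d + (4 * (1 + z) + 2 * (2 + p)) + (2 * q + d) + 1)
  e = solve-∀

-- Degrees and the minimum semidegree.

∣tabulate∣ : {P : Pred (Fin n) 0ℓ} (P? : Decidable P) → ∣ tabulate (does ∘ P?) ∣ ≡ ♯ P?
∣tabulate∣ {n = zero}  P? = refl
∣tabulate∣ {n = suc _} P? with does (P? zero)
... | true  = cong suc (∣tabulate∣ (P? ∘ suc))
... | false = ∣tabulate∣ (P? ∘ suc)

δ⁰≤ : ∀ {N} (H : OrientedGraph N) v →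
      δ⁰ H ≤ OrientedGraph.d⁺ H v ⊓ OrientedGraph.d⁻ H v
δ⁰≤ {suc N} H v =
  min≤v⁺ (semidegree zero) (List.tabulate semidegree)
    (inj₂ (Any.map (≤-reflexive ∘ sym) (∈-tabulate⁺ {f = semidegree} v)))
  where
  open OrientedGraph H
  semidegree : Fin (suc N) → ℕ
  semidegree v = d⁺ v ⊓ d⁻ v

-- Neighbourhoods of `x` and `y` when the short paths are missing.

module PathFree {N : ℕ} (H : OrientedGraph N) where

 open OrientedGraph H

 module _ {d : ℕ}
  (d≤out : ∀ v → d ≤ ♯ (v ⟶?_)) (d≤in : ∀ v → d ≤ ♯ (_⟶? v))
  (3≤d : 3 ≤ d) (2N+3≤7d : 2 * N + 3 ≤ 7 * d)
  {x y : Fin N}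
  (no3 : ∀ {a b} → x ⟶ a → a ≢ y → a ⟶ b → b ≢ x → b ⟶ y → ⊥)
  (no4 : ∀ {a c b} → x ⟶ a → a ≢ y → a ⟶ c → c ⟶ b → b ≢ x → b ⟶ y → ⊥)
  (no5 : ∀ {a c e b} → x ⟶ a → a ≢ y → a ⟶ c → c ≢ y → c ⟶ e → e ≢ x →
         e ⟶ b → b ≢ x → b ⟶ y → a ≢ b → ⊥)
  (x≢y : x ≢ y)
  where

  A B Z A′ B′ C D Special C° : Pred (Fin N) 0ℓ
  A v = x ⟶ v × v ≢ y
  B v = v ⟶ y × v ≢ x
  Z = A ∩ B
  A′ = A ∩ ∁ B
  B′ = B ∩ ∁ A
  C v = (∃ λ a → A a × a ⟶ v) × ¬ A v × v ≢ y
  D v = (∃ λ b → B b × v ⟶ b) × ¬ B v × v ≢ x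
  Special v = ∃ λ w → D w × v ⟶ w
  C° = C ∩ ∁ Special

  A? : Decidable A
  A? v = (x ⟶? v) ×-dec ¬? (v ≟ y)
  B? : Decidable B
  B? v = (v ⟶? y) ×-dec ¬? (v ≟ x)
  Z? : Decidable Z
  Z? = A? ∩? B?
  A′? : Decidable A′
  A′? = A? ∩? ∁? B?
  B′? : Decidable B′
  B′? = B? ∩? ∁? A?
  C? : Decidable C
  C? v = any? (λ a → A? a ×-dec (a ⟶? v)) ×-dec ¬? (A? v) ×-dec ¬? (v ≟ y)
  D? : Decidable D
  D? v = any? (λ b → B? b ×-dec (v ⟶? b)) ×-dec ¬? (B? v) ×-dec ¬? (v ≟ x)
  Special? : Decidable Special
  Special? v = any? (λ w → D? w ×-dec (v ⟶? w))
  C°? : Decidable C°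
  C°? = C? ∩? ∁? Special?

  -- `Rest` still contains `x` and the special vertices of `C`; arcs from `C°` may end there.
  Out Out° In Rest : Pred (Fin N) 0ℓ
  Out  = A′ ∪ C
  Out° = A′ ∪ C°
  In   = B′ ∪ D
  Rest = ∁ (((Out° ∪ In) ∪ Z) ∪ (_≡ y))

  Out? : Decidable Out
  Out? = A′? ∪? C?
  Out°? : Decidable Out°
  Out°? = A′? ∪? C°?
  In? : Decidable In
  In? = B′? ∪? D?
  Rest? : Decidable Rest
  Rest? = ∁? (((Out°? ∪? In?) ∪? Z?) ∪? (_≟ y))

  irrefl : ∀ {v} → ¬ v ⟶ v
  irrefl = loopless refl

  A⇒≢x : ∀ {v} → A v → v ≢ x
  A⇒≢x (x⟶v , _) refl = irrefl x⟶v

  B⇒≢y : ∀ {v} → B v → v ≢ y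
  B⇒≢y (v⟶y , _) refl = irrefl v⟶y

  no-AB : ∀ {a b} → A a → B b → ¬ a ⟶ b
  no-AB (xa , a≢y) (by , b≢x) ab = no3 xa a≢y ab b≢x by

  no-A-B : ∀ {a c b} → A a → a ⟶ c → c ⟶ b → ¬ B b
  no-A-B (xa , a≢y) ac cb (by , b≢x) = no4 xa a≢y ac cb b≢x by

  -- The paths of length 5 exclude an arc from C to D except where they would pass
  -- twice through a vertex of Z; these exceptions are the special vertices of C.
  C-D-arc : ∀ {a c e b} → A a → a ⟶ c → c ≢ y → c ⟶ e → e ≢ x → e ⟶ b → B b → a ≡ b
  C-D-arc {a} {b = b} (xa , a≢y) ac c≢y ce e≢x eb (by , b≢x) =
    decidable-stable (a ≟ b) (no5 xa a≢y ac c≢y ce e≢x eb b≢x by)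

  -- The vertex `w` has an arc to some `b` in `B`. If `b` were not `a`, then x, a, c, w, b, y would
  -- be a path of length 5; so `a`, `c`, `w` form a triangle.
  special-apex : ∀ {a c w} → A a → a ⟶ c → C c → c ⟶ w → D w → B a × w ⟶ a
  special-apex Aa ac (_ , _ , c≢y) cw ((b , Bb , wb) , _ , w≢x)
    with refl ← C-D-arc Aa ac c≢y cw w≢x wb Bb = Bb , wb

  -- By `special-apex`, `w` has an arc to `a′` in `B`, so `a′` can serve as the end `b` of a
  -- forbidden path through `a`.
  special-apex-unique : ∀ {a a′ c} → A a → A a′ → C c → Special c → a ⟶ c → a′ ⟶ c → a ≡ a′
  special-apex-unique Aa Aa′ Cc@(_ , _ , c≢y) (w , Dw@(_ , _ , w≢x) , cw) ac a′c =
    let Ba′ , wa′ = special-apex Aa′ a′c Cc cw Dw in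
    C-D-arc Aa ac c≢y cw w≢x wa′ Ba′

  A-out : ∀ {a v} → A a → a ⟶ v → v ≢ y → Out v
  A-out {a} {v} Aa av v≢y with A? v
  ... | yes Av = inj₁ (Av , λ Bv → no-AB Aa Bv av)
  ... | no ¬Av = inj₂ ((a , Aa , av) , ¬Av , v≢y)

  B-in : ∀ {b v} → B b → v ⟶ b → v ≢ x → In v
  B-in {b} {v} Bb vb v≢x with B? v
  ... | yes Bv = inj₁ (Bv , λ Av → no-AB Av Bb vb)
  ... | no ¬Bv = inj₂ ((b , Bb , vb) , ¬Bv , v≢x)

  -- An arc to `y`, or to a special vertex of `C`, would place `u` in `B`.
  A′-out : ∀ {u v} → A′ u → u ⟶ v → A′ v ⊎ C° v
  A′-out {u} {v} (Au , ¬Bu) uv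
    with A-out Au uv (λ { refl → ¬Bu (uv , A⇒≢x Au) })
  ... | inj₁ A′v = inj₁ A′v
  ... | inj₂ Cv  = inj₂ (Cv , λ (w , Dw , vw) → ¬Bu (proj₁ (special-apex Au uv Cv vw Dw)))

  B′-in : ∀ {u v} → B′ u → v ⟶ u → B′ v ⊎ D v
  B′-in (Bu , ¬Au) vu = B-in Bu vu λ { refl → ¬Au (vu , B⇒≢y Bu) }

  C⇒≢x : ∀ {v} → C v → v ≢ x
  C⇒≢x ((_ , (xa , _) , av) , _) refl = asym xa av

  D⇒≢y : ∀ {v} → D v → v ≢ y
  D⇒≢y ((_ , (by , _) , vb) , _) refl = asym by vb

  C⇒∁B : ∀ {v} → C v → ¬ B v
  C⇒∁B ((_ , Aa , av) , _) Bv = no-AB Aa Bv av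

  D⇒∁A : ∀ {v} → D v → ¬ A v
  D⇒∁A ((_ , Bb , vb) , _) Av = no-AB Av Bb vb

  C⇒∁D : ∀ {v} → C v → ¬ D v
  C⇒∁D ((_ , Aa , av) , _) ((_ , Bb , vb) , _) = no-A-B Aa av vb Bb

  -- A target in `B` completes a path of length 4, the target `y` one of length 3, and a target in
  -- `D` makes `u` special.
  C°-out : ∀ {u v} → C° u → u ⟶ v → Out° v ⊎ Rest v
  C°-out {u} {v} (Cu@((a , Aa , au) , _) , ¬special) uv with Out°? v
  ... | yes Pv = inj₁ Pv
  ... | no ¬Pv = inj₂ λ where
    (inj₁ (inj₁ (inj₁ Pv)))              → ¬Pv Pv
    (inj₁ (inj₁ (inj₂ (inj₁ (Bv , _))))) → no-A-B Aa au uv Bv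
    (inj₁ (inj₁ (inj₂ (inj₂ Dv))))       → ¬special (v , Dv , uv)
    (inj₁ (inj₂ (_ , Bv)))               → no-A-B Aa au uv Bv
    (inj₂ refl)                          → C⇒∁B Cu (uv , C⇒≢x Cu)

  Out°-out : ∀ {u v} → Out° u → u ⟶ v → Out° v ⊎ (C° u × Rest v)
  Out°-out (inj₁ A′u) uv = inj₁ (A′-out A′u uv)
  Out°-out (inj₂ C°u) uv with C°-out C°u uv
  ... | inj₁ Pv = inj₁ Pv
  ... | inj₂ Rv = inj₂ (C°u , Rv)

  Out°⊆Out : Out° ⊆ Out
  Out°⊆Out (inj₁ A′v)       = inj₁ A′v
  Out°⊆Out (inj₂ (Cv , _)) = inj₂ Cv

  Out∩In : Empty (Out ∩ In)
  Out∩In v (inj₁ (_ , ¬Bv) , inj₁ (Bv , _)) = ¬Bv Bv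
  Out∩In v (inj₁ (Av , _)  , inj₂ Dv)       = D⇒∁A Dv Av
  Out∩In v (inj₂ Cv        , inj₁ (Bv , _)) = C⇒∁B Cv Bv
  Out∩In v (inj₂ Cv        , inj₂ Dv)       = C⇒∁D Cv Dv

  [Out∪In]∩Z : Empty ((Out ∪ In) ∩ Z)
  [Out∪In]∩Z v (inj₁ (inj₁ (_ , ¬Bv))      , _ , Bv) = ¬Bv Bv
  [Out∪In]∩Z v (inj₁ (inj₂ (_ , ¬Av , _))  , Av , _) = ¬Av Av
  [Out∪In]∩Z v (inj₂ (inj₁ (_ , ¬Av))      , Av , _) = ¬Av Av
  [Out∪In]∩Z v (inj₂ (inj₂ (_ , ¬Bv , _))  , _ , Bv) = ¬Bv Bv

  y∉ : Empty (((Out ∪ In) ∪ Z) ∩ (_≡ y))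
  y∉ v (inj₁ (inj₁ (inj₁ ((_ , v≢y) , _)))  , v≡y) = v≢y v≡y
  y∉ v (inj₁ (inj₁ (inj₂ (_ , _ , v≢y)))    , v≡y) = v≢y v≡y
  y∉ v (inj₁ (inj₂ (inj₁ (Bv , _)))         , v≡y) = B⇒≢y Bv v≡y
  y∉ v (inj₁ (inj₂ (inj₂ Dv))               , v≡y) = D⇒≢y Dv v≡y
  y∉ v (inj₂ ((_ , v≢y) , _)                , v≡y) = v≢y v≡y

  x∉ : Empty ((((Out ∪ In) ∪ Z) ∪ (_≡ y)) ∩ (_≡ x))
  x∉ v (inj₁ (inj₁ (inj₁ (inj₁ (Av , _))))       , v≡x) = A⇒≢x Av v≡x
  x∉ v (inj₁ (inj₁ (inj₁ (inj₂ Cv)))             , v≡x) = C⇒≢x Cv v≡x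
  x∉ v (inj₁ (inj₁ (inj₂ (inj₁ ((_ , v≢x) , _)))) , v≡x) = v≢x v≡x
  x∉ v (inj₁ (inj₁ (inj₂ (inj₂ (_ , _ , v≢x))))  , v≡x) = v≢x v≡x
  x∉ v (inj₁ (inj₂ (Av , _))                     , v≡x) = A⇒≢x Av v≡x
  x∉ v (inj₂ v≡y                                 , v≡x) = x≢y (trans (sym v≡x) v≡y)

  -- Sizes of the pieces and the two cases for |Z|.

  p q z r k : ℕ
  p = ♯ Out°?
  q = ♯ In?
  z = ♯ Z?
  r = ♯ Rest?
  k = ♯ C°?

  p≡ : p ≡ ♯ A′? + k
  p≡ = ♯-∪ A′? C°? λ { v ((Av , _) , ((_ , ¬Av , _) , _)) → ¬Av Av }

  q≡ : q ≡ ♯ B′? + ♯ D?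
  q≡ = ♯-∪ B′? D? λ { v ((Bv , _) , (_ , ¬Bv , _)) → ¬Bv Bv }

  order : p + q + z + 1 + r ≡ N
  order = begin
    p + q + z + 1 + r
      ≡⟨ cong₂ (λ s t → s + z + t + r) (sym (♯-∪ Out°? In? λ v (Pv , Qv) → Out∩In v (Out°⊆Out Pv , Qv))) (sym (♯-singleton y)) ⟩
    ♯ (Out°? ∪? In?) + z + ♯ (_≟ y) + r
      ≡⟨ cong (λ s → s + ♯ (_≟ y) + r) (sym (♯-∪ (Out°? ∪? In?) Z? λ v (PQv , Zv) → [Out∪In]∩Z v (weaken PQv , Zv))) ⟩
    ♯ ((Out°? ∪? In?) ∪? Z?) + ♯ (_≟ y) + r
      ≡⟨ cong (_+ r) (sym (♯-∪ ((Out°? ∪? In?) ∪? Z?) (_≟ y) λ v (Uv , v≡y) → y∉ v (Sum.map₁ weaken Uv , v≡y))) ⟩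
    ♯ (((Out°? ∪? In?) ∪? Z?) ∪? (_≟ y)) + r
      ≡⟨ ♯-∁ (((Out°? ∪? In?) ∪? Z?) ∪? (_≟ y)) ⟩
    N ∎
    where
    open ≡-Reasoning
    weaken : Out° ∪ In ⊆ Out ∪ In
    weaken = Sum.map₁ Out°⊆Out

  -- Unlike in `order`, the special vertices of `C` are counted with `Out`; the final 2 accounts for
  -- `x` and `y`.
  order≥ : ♯ Out? + q + z + 2 ≤ N
  order≥ = begin
    ♯ Out? + q + z + 2
      ≡⟨ sym (+-assoc (♯ Out? + q + z) 1 1) ⟩
    ♯ Out? + q + z + 1 + 1
      ≡⟨ cong₂ (λ s t → s + z + t + 1) (sym (♯-∪ Out? In? Out∩In)) (sym (♯-singleton y)) ⟩
    ♯ (Out? ∪? In?) + z + ♯ (_≟ y) + 1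
      ≡⟨ cong₂ (λ s t → s + ♯ (_≟ y) + t) (sym (♯-∪ (Out? ∪? In?) Z? [Out∪In]∩Z)) (sym (♯-singleton x)) ⟩
    ♯ ((Out? ∪? In?) ∪? Z?) + ♯ (_≟ y) + ♯ (_≟ x)
      ≡⟨ cong (_+ ♯ (_≟ x)) (sym (♯-∪ ((Out? ∪? In?) ∪? Z?) (_≟ y) y∉)) ⟩
    ♯ (((Out? ∪? In?) ∪? Z?) ∪? (_≟ y)) + ♯ (_≟ x)
      ≤⟨ ♯-pack (((Out? ∪? In?) ∪? Z?) ∪? (_≟ y)) (_≟ x) all? x∉ (λ u → inj₁ u) inj₂ ⟩
    ♯ all?
      ≤⟨ m≤m+n _ _ ⟩
    ♯ all? + ♯ (∁? all?)
      ≡⟨ ♯-∁ all? ⟩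
    N ∎
    where
    open ≤-Reasoning
    all? = (((Out? ∪? In?) ∪? Z?) ∪? (_≟ y)) ∪? (_≟ x)

  d≤1+A′+Z : d ≤ 1 + (♯ A′? + z)
  d≤1+A′+Z = ≤-trans (d≤out x) (≤-trans
    (♯-except y (x ⟶?_) A? _,_)
    (+-monoʳ-≤ 1 (♯-cover A? A′? Z? split)))
    where
    split : A ⊆ A′ ∪ Z
    split {v} Av with B? v
    ... | yes Bv = inj₂ (Av , Bv)
    ... | no ¬Bv = inj₁ (Av , ¬Bv)

  d≤1+B′+Z : d ≤ 1 + (♯ B′? + z)
  d≤1+B′+Z = ≤-trans (d≤in y) (≤-trans
    (♯-except x (_⟶? y) B? _,_)
    (+-monoʳ-≤ 1 (♯-cover B? B′? Z? split)))
    where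
    split : B ⊆ B′ ∪ Z
    split {v} Bv with A? v
    ... | yes Av = inj₂ (Av , Bv)
    ... | no ¬Av = inj₁ (Bv , ¬Av)

  -- Rest omits y; when |Z| = d − 1 the final estimate has no unit to spare for it.
  Out°-arcs : 2 * (p * d) + p ≤ p * p + 2 * (k * r)
  Out°-arcs = outdegree-bound _⟶?_ asym d Out°? C°? Rest? d≤out Out°-out

  z+2≤d-impossible : 2 + z ≤ d → ⊥
  z+2≤d-impossible 2+z≤d = small-intersection {a = ♯ A′?} {♯ B′?} {k} {♯ D?} {z} {r}
    2+z≤d d≤1+A′+Z d≤1+B′+Z
    (subst (λ p → 2 * (p * d) + p ≤ p * p + 2 * (k * r)) p≡ Out°-arcs)
    -- Arcs that leave `A′` all end in `C°`, so `A′` serves both as the set counted and as `K`. The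
    -- reversed relation does the same for `B′` and `D`.
    (outdegree-bound _⟶?_ asym d A′? A′? C°? d≤out
      λ A′u uv → Sum.map₂ (A′u ,_) (A′-out A′u uv))
    (outdegree-bound (flip _⟶?_) asym d B′? B′? D? d≤in
      λ B′u vu → Sum.map₂ (B′u ,_) (B′-in B′u vu))
    (subst (λ q → ♯ A′? + k + q + z + 1 + r ≡ N) q≡
      (subst (λ p → p + q + z + 1 + r ≡ N) p≡ order))
    2N+3≤7d

  SpecialOut : Fin N → Pred (Fin N) 0ℓ
  SpecialOut t = (C ∩ Special) ∩ (t ⟶_)

  SpecialOut? : ∀ t → Decidable (SpecialOut t)
  SpecialOut? t = (C? ∩? Special?) ∩? (t ⟶?_)

  d≤1+z-impossible : d ≤ 1 + z → ⊥
  d≤1+z-impossible d≤1+z with any? (λ t → Z? t ×-dec ¬? (any? (SpecialOut? t)))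
  -- Without special out-neighbours, all out-neighbours of `t` except `y` lie in `Out°`.
  ... | yes (t , (At , Bt) , none) = large-intersection {p = p} {q} {k} {z} {r}
    (≤-trans (n≤1+n 2) 3≤d) d≤1+z
    (≤-trans (d≤out t) (♯-except y (t ⟶?_) Out°? out))
    (≤-trans (d≤in t) (♯-except x (_⟶? t) In? (B-in Bt)))
    (♯-mono C°? Out°? inj₂) Out°-arcs order 2N+3≤7d
    where
    out : ∀ {v} → t ⟶ v → v ≢ y → Out° v
    out {v} tv v≢y with A-out At tv v≢y
    ... | inj₁ A′v = inj₁ A′v
    ... | inj₂ Cv  = inj₂ (Cv , λ special → none (v , (Cv , special) , tv))
  -- Now every vertex of `Z` has a special out-neighbour, and `Z` is nonempty since |Z| ≥ d - 1 ≥ 2.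
  ... | no ¬none with ♯-inhabited Z? (≤-trans (n≤1+n 1) (+-cancelˡ-≤ 1 _ _ (≤-trans 3≤d d≤1+z)))
  ... | t , At , Bt = huge-neighbourhoods {p = ♯ Out?} {q} {z}
    3≤d d≤1+z
    (begin
      d + z
        ≤⟨ +-mono-≤ (d≤out t) z≤ ⟩
      ♯ (t ⟶?_) + (1 + ♯ Z-t?)
        ≤⟨ +-mono-≤ (♯-except y (t ⟶?_) X? λ tv v≢y → A-out At tv v≢y , tv)
             -- A special vertex of `C` has only one in-neighbour in `A`. So the vertices of `Z`
             -- other than `t` have distinct special out-neighbours, none of which is an
             -- out-neighbour of `t`.
             (+-monoʳ-≤ 1 (♯-injection _⟶?_ Z-t? Y? image
               λ (((Ai , _) , _)) ((Ai′ , _) , _) ((Cj , special) , _) →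
                 special-apex-unique Ai Ai′ Cj special)) ⟩
      1 + ♯ X? + (1 + ♯ Y?)
        ≡⟨ cong suc (+-suc (♯ X?) (♯ Y?)) ⟩
      2 + (♯ X? + ♯ Y?)
        ≤⟨ +-monoʳ-≤ 2 (♯-pack X? Y? Out? (λ { v ((_ , tv) , (_ , ¬tv)) → ¬tv tv })
             proj₁ (inj₂ ∘ proj₁ ∘ proj₁)) ⟩
      2 + ♯ Out? ∎)
    d≤q order≥ 2N+3≤7d
    where
    open ≤-Reasoning
    special : ∀ {t} → Z t → ∃ (SpecialOut t)
    special {t} Zt = decidable-stable (any? (SpecialOut? t)) λ none → ¬none (t , Zt , none)
    Z-t? : Decidable (Z ∩ (_≢ t))
    Z-t? = Z? ∩? (λ v → ¬? (v ≟ t))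
    X? : Decidable (Out ∩ (t ⟶_))
    X? = Out? ∩? (t ⟶?_)
    Y? : Decidable ((C ∩ Special) ∩ ∁ (t ⟶_))
    Y? = (C? ∩? Special?) ∩? ∁? (t ⟶?_)
    z≤ : z ≤ 1 + ♯ Z-t?
    z≤ = ♯-except t Z? Z-t? _,_
    image : ∀ {t′} → (Z ∩ (_≢ t)) t′ → ∃ λ c → ((C ∩ Special) ∩ ∁ (t ⟶_)) c × t′ ⟶ c
    image (Zt′ , t′≢t) with special Zt′
    ... | c , (Cc , sp) , t′c =
      c , ((Cc , sp) , λ tc → t′≢t (special-apex-unique (proj₁ Zt′) At Cc sp t′c tc)) , t′c
    -- Gains one over counting the in-neighbours of `t` other than `x`. Since |Z| ≥ 2, another `t′`
    -- in `Z` starts arcs t′ → c → w with `w` in `D`, and an arc from `w` to `t` would complete a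
    -- path of length 5.
    d≤q : d ≤ q
    d≤q with ♯-inhabited Z-t? (+-cancelˡ-≤ 2 _ _ (≤-trans 3≤d (≤-trans d≤1+z (s≤s z≤))))
    ... | t′ , (At′ , Bt′) , t′≢t with special (At′ , Bt′)
    ... | c , (Cc@(_ , _ , c≢y) , w , Dw@(_ , _ , w≢x) , cw) , t′c = +-cancelˡ-≤ 1 _ _ (begin
      1 + d                   ≡⟨ +-comm 1 d ⟩
      d + 1                   ≤⟨ +-mono-≤ (d≤in t) (≤-reflexive (sym (♯-singleton w))) ⟩
      ♯ (_⟶? t) + ♯ (_≟ w)    ≡⟨ sym (♯-∪ (_⟶? t) (_≟ w) w∉) ⟩
      ♯ ((_⟶? t) ∪? (_≟ w))   ≤⟨ ♯-except x ((_⟶? t) ∪? (_≟ w)) In?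
                                   (λ { (inj₁ vt) → B-in Bt vt ; (inj₂ refl) _ → inj₂ Dw }) ⟩
      1 + q                   ∎)
      where
      w∉ : Empty ((_⟶ t) ∩ (_≡ w))
      w∉ v (vt , refl) = t′≢t (C-D-arc At′ t′c c≢y cw w≢x vt Bt)

  impossible : ⊥
  impossible with d ≤? 1 + z
  ... | yes d≤1+z = d≤1+z-impossible d≤1+z
  ... | no  d≰1+z = z+2≤d-impossible (≰⇒> d≰1+z)

-- Searching for the paths and assembling the theorem.

arc⇒≢ : ∀ {N} (H : OrientedGraph N) (let open OrientedGraph H) {u v} → u ⟶ v → u ≢ v
arc⇒≢ H = flip (OrientedGraph.loopless H)

lemma2p2 : (N : ℕ) (H : OrientedGraph N) →
    let d = δ⁰ H in
    d ≥ 3 → 7 * d ≥ 2 * N + 3 →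
    (x y : Fin N) → x ≢ y →
    Path H x y 3 ⊎ Path H x y 4 ⊎ Path H x y 5
lemma2p2 N H 3≤d 2N+3≤7d x y x≢y
  -- Each search tests only the inequalities that follow neither from the arcs nor from the failure
  -- of an earlier search.
  with any? (λ a → any? λ b → (x ⟶? a) ×-dec ¬? (a ≟ y) ×-dec (a ⟶? b) ×-dec ¬? (b ≟ x) ×-dec (b ⟶? y))
  where open OrientedGraph H
... | yes (a , b , xa , a≢y , ab , b≢x , by) = inj₁ record
  { vertices = x ∷ a ∷ b ∷ y ∷ []
  ; starts = refl
  ; ends = refl
  ; arcs = xa Linked.∷ ab Linked.∷ by Linked.∷ Linked.[-]
  ; simple =
      (arc⇒≢ H xa ∷ ≢-sym b≢x ∷ x≢y ∷ []) AllPairs.∷ (arc⇒≢ H ab ∷ a≢y ∷ []) AllPairs.∷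
      (arc⇒≢ H by ∷ []) AllPairs.∷ [] AllPairs.∷ AllPairs.[]
  }
  where open OrientedGraph H
... | no ¬3 with any? (λ a → any? λ c → any? λ b →
    (x ⟶? a) ×-dec ¬? (a ≟ y) ×-dec (a ⟶? c) ×-dec (c ⟶? b) ×-dec ¬? (b ≟ x) ×-dec (b ⟶? y))
  where open OrientedGraph H
... | yes (a , c , b , xa , a≢y , ac , cb , b≢x , by) = inj₂ (inj₁ record
  { vertices = x ∷ a ∷ c ∷ b ∷ y ∷ []
  ; starts = refl
  ; ends = refl
  ; arcs = xa Linked.∷ ac Linked.∷ cb Linked.∷ by Linked.∷ Linked.[-]
  ; simple =
      (arc⇒≢ H xa ∷ (λ { refl → asym xa ac }) ∷ ≢-sym b≢x ∷ x≢y ∷ []) AllPairs.∷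
      (arc⇒≢ H ac ∷ (λ { refl → asym ac cb }) ∷ a≢y ∷ []) AllPairs.∷
      (arc⇒≢ H cb ∷ (λ { refl → asym cb by }) ∷ []) AllPairs.∷
      (arc⇒≢ H by ∷ []) AllPairs.∷ [] AllPairs.∷ AllPairs.[]
  })
  where open OrientedGraph H
... | no ¬4 with any? (λ a → any? λ c → any? λ e → any? λ b →
    (x ⟶? a) ×-dec ¬? (a ≟ y) ×-dec (a ⟶? c) ×-dec ¬? (c ≟ y) ×-dec (c ⟶? e) ×-dec ¬? (e ≟ x) ×-dec
    (e ⟶? b) ×-dec ¬? (b ≟ x) ×-dec (b ⟶? y) ×-dec ¬? (a ≟ b))
  where open OrientedGraph H
... | yes (a , c , e , b , xa , a≢y , ac , c≢y , ce , e≢x , eb , b≢x , by , a≢b) = inj₂ (inj₂ record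
  { vertices = x ∷ a ∷ c ∷ e ∷ b ∷ y ∷ []
  ; starts = refl
  ; ends = refl
  ; arcs = xa Linked.∷ ac Linked.∷ ce Linked.∷ eb Linked.∷ by Linked.∷ Linked.[-]
  ; simple =
      (arc⇒≢ H xa ∷ (λ { refl → asym xa ac }) ∷ ≢-sym e≢x ∷ ≢-sym b≢x ∷ x≢y ∷ []) AllPairs.∷
      -- If `a` = `e`, or `c` = `b` in the next row, the walk shortens to a path of length 3.
      (arc⇒≢ H ac ∷ (λ { refl → ¬3 (_ , _ , xa , a≢y , eb , b≢x , by) }) ∷ a≢b ∷ a≢y ∷ []) AllPairs.∷
      (arc⇒≢ H ce ∷ (λ { refl → ¬3 (_ , _ , xa , a≢y , ac , b≢x , by) }) ∷ c≢y ∷ []) AllPairs.∷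
      (arc⇒≢ H eb ∷ (λ { refl → asym eb by }) ∷ []) AllPairs.∷
      (arc⇒≢ H by ∷ []) AllPairs.∷ [] AllPairs.∷ AllPairs.[]
  })
  where open OrientedGraph H
... | no ¬5 = ⊥-elim (PathFree.impossible H
  (λ v → ≤-trans (δ⁰≤ H v) (≤-trans (m⊓n≤m _ _) (≤-reflexive (∣tabulate∣ (v ⟶?_)))))
  (λ v → ≤-trans (δ⁰≤ H v) (≤-trans (m⊓n≤n (d⁺ v) _) (≤-reflexive (∣tabulate∣ (_⟶? v)))))
  3≤d 2N+3≤7d
  (λ xa a≢y ab b≢x by → ¬3 (_ , _ , xa , a≢y , ab , b≢x , by))
  (λ xa a≢y ac cb b≢x by → ¬4 (_ , _ , _ , xa , a≢y , ac , cb , b≢x , by))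
  (λ xa a≢y ac c≢y ce e≢x eb b≢x by a≢b →
    ¬5 (_ , _ , _ , _ , xa , a≢y , ac , c≢y , ce , e≢x , eb , b≢x , by , a≢b))
  x≢y)
  where open OrientedGraph H
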